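{- Let $\mathcal{C}$ be a finitely complete category that has coequalizers and in which regular epimorphisms are closed under composition, let $H\colon\mathcal{C}\to\mathcal{C}$ preserve monomorphisms, let $\xi\colon X\to HX$ be an $H$-coalgebra, and let a $\mathsf{select}$ routine be given. Let $P_i$, $Q_i$ be the kernels on $X$ computed by the categorical partition refinement algorithm. If $P_i=Q_i$ for some $i$, then $\xi/Q_i\colon X/Q_i\to H(X/Q_i)$ is a simple coalgebra.
   Context: The kernel $\ker f$ of $f\colon X\to Y$ is its kernel pair $\ker f\rightrightarrows X$, regarded as a subobject of $X\times X$; a kernel on $X$ is the kernel of some morphism with domain $X$. For a kernel $R\rightrightarrows X$, $\kappa_R\colon X\twoheadrightarrow X/R$ is its coequalizer. $R$ is finer than $R'$ if $R\le R'$ as subobjects of $X\times X$; $\cap$ is intersection of subobjects. Equality of kernels means equality as subobjects. A $\mathsf{select}$ routine is an operation that receives a chain of regular epimorphisms $X\xrightarrow{y}Y\xrightarrow{z}Z$ and returns some morphism $\mathsf{select}(y,z)\colon Y\to K$ (for some object $K$). Algorithm (categorical partition refinement): given $\xi\colon X\to HX$, put $Q_0=X\times X$, $\bar q_0=\,!\colon X\to 1=K_0$, $P_0=\ker(X\xrightarrow{\xi}HX\xrightarrow{H!}H1)$. Then for $i=0,1,2,\dots$ (while $P_i$ is properly finer than $Q_i$) put: (1) $q_{i+1}=\mathsf{select}(\kappa_{P_i},f_i)\cdot\kappa_{P_i}\colon X\to K_{i+1}$, where $f_i\colon X/P_i\twoheadrightarrow X/Q_i$ is the unique morphism with $f_i\cdot\kappa_{P_i}=\kappa_{Q_i}$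 (it exists because $P_i$ is always finer than $Q_i$), and $\bar q_{i+1}=\langle\bar q_i,q_{i+1}\rangle\colon X\to\prod_{j\le i+1}K_j$; (2) $Q_{i+1}=\ker\bar q_{i+1}=Q_i\cap\ker q_{i+1}$; (3) $P_{i+1}=\ker(X\xrightarrow{\xi}HX\xrightarrow{H\bar q_{i+1}}H\prod_{j\le i+1}K_j)$. The morphism $\xi/Q_i\colon X/P_i\to H(X/Q_i)$ is the unique morphism with $(\xi/Q_i)\cdot\kappa_{P_i}=H\kappa_{Q_i}\cdot\xi$ (which exists for all $i$); when $P_i=Q_i$ it is a coalgebra structure on $X/Q_i$. A coalgebra morphism $h\colon(X,\xi)\to(Y,\zeta)$ is a morphism with $\zeta\cdot h=Hh\cdot\xi$. A quotient of a coalgebra is a coalgebra morphism carried by a regular epimorphism of $\mathcal{C}$; a coalgebra is simple if every quotient of it is an isomorphism. -}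

module Defs where

open import Level using (Level; _⊔_) renaming (suc to lsuc)
open import Data.Nat.Base using (ℕ; zero; suc)
open import Data.Product.Base using (Σ-syntax; ∃-syntax; _×_; _,_; proj₁; proj₂)
open import Relation.Binary.Bundles using (Setoid)
open import Relation.Binary.Structures using (IsEquivalence)
import Relation.Binary.Reasoning.Setoid as SetoidReasoning

-- Equality of morphisms is a setoid equality; objects are only ever compared
-- up to isomorphism.
record Category (o ℓ e : Level) : Set (lsuc (o ⊔ ℓ ⊔ e)) where
  infix  4 _≈_ _⇒_
  infixr 9 _∘_
  field
    Obj       : Set o
    _⇒_       : Obj → Obj → Set ℓ
    _≈_       : ∀ {A B} → A ⇒ B → A ⇒ B → Set e
    id        : ∀ {A} → A ⇒ A
    _∘_       : ∀ {A B C} → B ⇒ C → A ⇒ B → A ⇒ C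
    equiv     : ∀ {A B} → IsEquivalence (_≈_ {A} {B})
    assoc     : ∀ {A B C D} {f : A ⇒ B} {g : B ⇒ C} {h : C ⇒ D} →
                (h ∘ g) ∘ f ≈ h ∘ (g ∘ f)
    identityˡ : ∀ {A B} {f : A ⇒ B} → id ∘ f ≈ f
    identityʳ : ∀ {A B} {f : A ⇒ B} → f ∘ id ≈ f
    ∘-resp-≈  : ∀ {A B C} {f h : B ⇒ C} {g i : A ⇒ B} →
                f ≈ h → g ≈ i → f ∘ g ≈ h ∘ i

  hom-setoid : Obj → Obj → Setoid ℓ e
  hom-setoid A B = record { Carrier = A ⇒ B ; _≈_ = _≈_ ; isEquivalence = equiv }

  module _ {A B : Obj} where
    open IsEquivalence (equiv {A} {B}) public
      using () renaming (refl to ≈-refl; sym to ≈-sym; trans to ≈-trans)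
    module HomReasoning = SetoidReasoning (hom-setoid A B)

  ∘-resp-≈ˡ : ∀ {A B C} {f h : B ⇒ C} {g : A ⇒ B} → f ≈ h → f ∘ g ≈ h ∘ g
  ∘-resp-≈ˡ p = ∘-resp-≈ p ≈-refl

  ∘-resp-≈ʳ : ∀ {A B C} {f : B ⇒ C} {g i : A ⇒ B} → g ≈ i → f ∘ g ≈ f ∘ i
  ∘-resp-≈ʳ p = ∘-resp-≈ ≈-refl p

record Functor {o ℓ e o′ ℓ′ e′ : Level} (C : Category o ℓ e) (D : Category o′ ℓ′ e′) :
    Set (o ⊔ ℓ ⊔ e ⊔ o′ ⊔ ℓ′ ⊔ e′) where
  private
    module C = Category C
    module D = Category D
  field
    F₀           : C.Obj → D.Obj
    F₁           : ∀ {A B} → A C.⇒ B → F₀ A D.⇒ F₀ B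
    identity     : ∀ {A} → F₁ (C.id {A}) D.≈ D.id
    homomorphism : ∀ {X Y Z} {f : X C.⇒ Y} {g : Y C.⇒ Z} →
                   F₁ (g C.∘ f) D.≈ F₁ g D.∘ F₁ f
    F-resp-≈     : ∀ {A B} {f g : A C.⇒ B} → f C.≈ g → F₁ f D.≈ F₁ g

module _ {o ℓ e : Level} (C : Category o ℓ e) where
  open Category C

  IsMono : ∀ {A B} → A ⇒ B → Set (o ⊔ ℓ ⊔ e)
  IsMono {A} f = ∀ {Z} (u v : Z ⇒ A) → f ∘ u ≈ f ∘ v → u ≈ v

  record IsIso {A B} (f : A ⇒ B) : Set (ℓ ⊔ e) where
    field
      inv  : B ⇒ A
      isoˡ : inv ∘ f ≈ id
      isoʳ : f ∘ inv ≈ id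

  record Terminal : Set (o ⊔ ℓ ⊔ e) where
    field
      𝟙        : Obj
      !        : ∀ {A} → A ⇒ 𝟙
      !-unique : ∀ {A} (f : A ⇒ 𝟙) → ! ≈ f

  record Product (A B : Obj) : Set (o ⊔ ℓ ⊔ e) where
    field
      A×B      : Obj
      π₁       : A×B ⇒ A
      π₂       : A×B ⇒ B
      ⟨_,_⟩    : ∀ {Z} → Z ⇒ A → Z ⇒ B → Z ⇒ A×B
      project₁ : ∀ {Z} {f : Z ⇒ A} {g : Z ⇒ B} → π₁ ∘ ⟨ f , g ⟩ ≈ f
      project₂ : ∀ {Z} {f : Z ⇒ A} {g : Z ⇒ B} → π₂ ∘ ⟨ f , g ⟩ ≈ g
      unique   : ∀ {Z} {f : Z ⇒ A} {g : Z ⇒ B} {h : Z ⇒ A×B} →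
                 π₁ ∘ h ≈ f → π₂ ∘ h ≈ g → ⟨ f , g ⟩ ≈ h

  record Equalizer {A B} (f g : A ⇒ B) : Set (o ⊔ ℓ ⊔ e) where
    field
      apex     : Obj
      arr      : apex ⇒ A
      equality : f ∘ arr ≈ g ∘ arr
      equalize : ∀ {Z} {h : Z ⇒ A} → f ∘ h ≈ g ∘ h → Z ⇒ apex
      factor   : ∀ {Z} {h : Z ⇒ A} (p : f ∘ h ≈ g ∘ h) → arr ∘ equalize p ≈ h
      unique   : ∀ {Z} {h : Z ⇒ A} {k : Z ⇒ apex} (p : f ∘ h ≈ g ∘ h) →
                 arr ∘ k ≈ h → k ≈ equalize p

  record IsPullback {R A B D} (p₁ : R ⇒ A) (p₂ : R ⇒ B) (f : A ⇒ D) (g : B ⇒ D) :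
      Set (o ⊔ ℓ ⊔ e) where
    field
      commute   : f ∘ p₁ ≈ g ∘ p₂
      universal : ∀ {Z} {h : Z ⇒ A} {k : Z ⇒ B} → f ∘ h ≈ g ∘ k → Z ⇒ R
      factor₁   : ∀ {Z} {h : Z ⇒ A} {k : Z ⇒ B} (eq : f ∘ h ≈ g ∘ k) →
                  p₁ ∘ universal eq ≈ h
      factor₂   : ∀ {Z} {h : Z ⇒ A} {k : Z ⇒ B} (eq : f ∘ h ≈ g ∘ k) →
                  p₂ ∘ universal eq ≈ k
      unique    : ∀ {Z} {u v : Z ⇒ R} → p₁ ∘ u ≈ p₁ ∘ v → p₂ ∘ u ≈ p₂ ∘ v → u ≈ v

  record Pullback {A B D} (f : A ⇒ D) (g : B ⇒ D) : Set (o ⊔ ℓ ⊔ e) where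
    field
      apex       : Obj
      p₁         : apex ⇒ A
      p₂         : apex ⇒ B
      isPullback : IsPullback p₁ p₂ f g

  record IsCoequalizer {A B E} (f g : A ⇒ B) (c : B ⇒ E) : Set (o ⊔ ℓ ⊔ e) where
    field
      equality   : c ∘ f ≈ c ∘ g
      coequalize : ∀ {Z} {h : B ⇒ Z} → h ∘ f ≈ h ∘ g → E ⇒ Z
      factor     : ∀ {Z} {h : B ⇒ Z} (p : h ∘ f ≈ h ∘ g) → coequalize p ∘ c ≈ h
      unique     : ∀ {Z} {h : B ⇒ Z} {k : E ⇒ Z} (p : h ∘ f ≈ h ∘ g) →
                   k ∘ c ≈ h → k ≈ coequalize p

  record Coequalizer {A B} (f g : A ⇒ B) : Set (o ⊔ ℓ ⊔ e) where
    field
      obj           : Obj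
      arr           : B ⇒ obj
      isCoequalizer : IsCoequalizer f g arr

  record FinitelyComplete : Set (o ⊔ ℓ ⊔ e) where
    field
      terminal  : Terminal
      product   : ∀ A B → Product A B
      equalizer : ∀ {A B} (f g : A ⇒ B) → Equalizer f g

  HasCoequalizers : Set (o ⊔ ℓ ⊔ e)
  HasCoequalizers = ∀ {A B} (f g : A ⇒ B) → Coequalizer f g

  IsRegularEpi : ∀ {A B} → A ⇒ B → Set (o ⊔ ℓ ⊔ e)
  IsRegularEpi {A} c = ∃[ R ] Σ[ f ∈ R ⇒ A ] Σ[ g ∈ R ⇒ A ] IsCoequalizer f g c

  RegularEpisCompose : Set (o ⊔ ℓ ⊔ e)
  RegularEpisCompose = ∀ {X Y Z} (g : Y ⇒ Z) (f : X ⇒ Y) →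
    IsRegularEpi g → IsRegularEpi f → IsRegularEpi (g ∘ f)

  record SelectRoutine : Set (o ⊔ ℓ ⊔ e) where
    field
      target : ∀ {X Y Z} (y : X ⇒ Y) (z : Y ⇒ Z) →
               IsRegularEpi y → IsRegularEpi z → Obj
      select : ∀ {X Y Z} (y : X ⇒ Y) (z : Y ⇒ Z)
               (ry : IsRegularEpi y) (rz : IsRegularEpi z) → Y ⇒ target y z ry rz

  record Subobject (A : Obj) : Set (o ⊔ ℓ ⊔ e) where
    field
      dom  : Obj
      arr  : dom ⇒ A
      mono : IsMono arr

  infix 4 _⊑_ _≋_

  record _⊑_ {A} (R S : Subobject A) : Set (ℓ ⊔ e) where
    constructor _,_
    private
      module R = Subobject R
      module S = Subobject S
    field
      through  : R.dom ⇒ S.dom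
      triangle : S.arr ∘ through ≈ R.arr

  _≋_ : ∀ {A} → Subobject A → Subobject A → Set (ℓ ⊔ e)
  R ≋ S = R ⊑ S × S ⊑ R

  full : ∀ A → Subobject A
  full A = record
    { dom  = A
    ; arr  = id
    ; mono = λ u v p → ≈-trans (≈-sym identityˡ) (≈-trans p identityˡ)
    }

module _ {o ℓ e : Level} {C : Category o ℓ e} where
  open Category C

  coequalizer-epi : ∀ {A B E Z} {f g : A ⇒ B} {c : B ⇒ E} → IsCoequalizer C f g c →
                    {u v : E ⇒ Z} → u ∘ c ≈ v ∘ c → u ≈ v
  coequalizer-epi {f = f} {g} {c} isC {u} {v} p =
    ≈-trans (unique q p) (≈-sym (unique q ≈-refl))
    where
    open IsCoequalizer isC
    q : (v ∘ c) ∘ f ≈ (v ∘ c) ∘ g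
    q = ≈-trans assoc (≈-trans (∘-resp-≈ʳ equality) (≈-sym assoc))

  -- If f ∘ c is a regular epimorphism and c is epic then f is a regular epimorphism.
  regularEpi-cancel : ∀ {X Y Z} {c : X ⇒ Y} {f : Y ⇒ Z} {d : X ⇒ Z} →
                      (∀ {W} {u v : Y ⇒ W} → u ∘ c ≈ v ∘ c → u ≈ v) →
                      f ∘ c ≈ d → IsRegularEpi C d → IsRegularEpi C f
  regularEpi-cancel {c = c} {f} {d} epi fc≈d (R , a , b , isC) =
    R , c ∘ a , c ∘ b , record
      { equality   = ≈-trans (pull a) (≈-trans D.equality (≈-sym (pull b)))
      ; coequalize = λ p → D.coequalize (shift p)
      ; factor     = λ p → epi (≈-trans assoc (≈-trans (∘-resp-≈ʳ fc≈d) (D.factor (shift p))))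
      ; unique     = λ p q → D.unique (shift p)
          (≈-trans (∘-resp-≈ʳ (≈-sym fc≈d)) (≈-trans (≈-sym assoc) (∘-resp-≈ˡ q)))
      }
    where
    module D = IsCoequalizer isC
    pull : ∀ x → f ∘ (c ∘ x) ≈ d ∘ x
    pull x = ≈-trans (≈-sym assoc) (∘-resp-≈ˡ fc≈d)
    shift : ∀ {W} {h : _ ⇒ W} → h ∘ (c ∘ a) ≈ h ∘ (c ∘ b) → (h ∘ c) ∘ a ≈ (h ∘ c) ∘ b
    shift p = ≈-trans assoc (≈-trans p (≈-sym assoc))

module _ {o ℓ e : Level} {C : Category o ℓ e} (H : Functor C C) where
  open Category C
  open Functor H

  PreservesMonos : Set (o ⊔ ℓ ⊔ e)
  PreservesMonos = ∀ {A B} (f : A ⇒ B) → IsMono C f → IsMono C (F₁ f)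

  record Coalgebra : Set (o ⊔ ℓ) where
    field
      Carrier   : Obj
      structure : Carrier ⇒ F₀ Carrier

  record CoalgebraMorphism (A B : Coalgebra) : Set (ℓ ⊔ e) where
    private
      module A = Coalgebra A
      module B = Coalgebra B
    field
      map      : A.Carrier ⇒ B.Carrier
      commutes : B.structure ∘ map ≈ F₁ map ∘ A.structure

  open CoalgebraMorphism

  Coalgebras : Category (o ⊔ ℓ) (ℓ ⊔ e) e
  Coalgebras = record
    { Obj       = Coalgebra
    ; _⇒_       = CoalgebraMorphism
    ; _≈_       = λ f g → map f ≈ map g
    ; id        = record
        { map      = id
        ; commutes = ≈-trans identityʳ (≈-trans (≈-sym identityˡ) (∘-resp-≈ˡ (≈-sym identity)))
        }
    ; _∘_       = λ g f → record
        { map      = map g ∘ map f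
        ; commutes = ≈-trans (≈-sym assoc) (≈-trans (∘-resp-≈ˡ (commutes g)) (≈-trans assoc
            (≈-trans (∘-resp-≈ʳ (commutes f)) (≈-trans (≈-sym assoc) (∘-resp-≈ˡ (≈-sym homomorphism))))))
        }
    ; equiv     = record { refl = ≈-refl ; sym = ≈-sym ; trans = ≈-trans }
    ; assoc     = assoc
    ; identityˡ = identityˡ
    ; identityʳ = identityʳ
    ; ∘-resp-≈  = ∘-resp-≈
    }

  IsQuotient : ∀ {A B} → CoalgebraMorphism A B → Set (o ⊔ ℓ ⊔ e)
  IsQuotient h = IsRegularEpi C (map h)

  IsSimple : Coalgebra → Set (o ⊔ ℓ ⊔ e)
  IsSimple A = ∀ B (h : CoalgebraMorphism A B) → IsQuotient h → IsIso Coalgebras h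

module Kernels {o ℓ e : Level} (C : Category o ℓ e) (finComplete : FinitelyComplete C) where
  open Category C
  open FinitelyComplete finComplete
  open Terminal terminal public using (𝟙; !)

  infixr 7 _⊗_

  _⊗_ : Obj → Obj → Obj
  A ⊗ B = Product.A×B (product A B)

  module _ {A B : Obj} where
    open Product (product A B) public
      using (π₁; π₂; ⟨_,_⟩; project₁; project₂) renaming (unique to ⟨⟩-unique)

  π-jointly-monic : ∀ {Z A B} {u v : Z ⇒ A ⊗ B} → π₁ ∘ u ≈ π₁ ∘ v → π₂ ∘ u ≈ π₂ ∘ v → u ≈ v
  π-jointly-monic p q = ≈-trans (≈-sym (⟨⟩-unique p q)) (⟨⟩-unique ≈-refl ≈-refl)

  pullback : ∀ {A B D} (f : A ⇒ D) (g : B ⇒ D) → Pullback C f g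
  pullback f g = record
    { apex       = E.apex
    ; p₁         = π₁ ∘ E.arr
    ; p₂         = π₂ ∘ E.arr
    ; isPullback = record
        { commute   = ≈-trans (≈-sym assoc) (≈-trans E.equality assoc)
        ; universal = λ p → E.equalize (pair p)
        ; factor₁   = λ p → ≈-trans assoc (≈-trans (∘-resp-≈ʳ (E.factor (pair p))) project₁)
        ; factor₂   = λ p → ≈-trans assoc (≈-trans (∘-resp-≈ʳ (E.factor (pair p))) project₂)
        ; unique    = λ {_} {u} {v} p q → arr-monic
            (π-jointly-monic (≈-trans (≈-sym assoc) (≈-trans p assoc))
                             (≈-trans (≈-sym assoc) (≈-trans q assoc)))
        }
    }
    where
    module E = Equalizer (equalizer (f ∘ π₁) (g ∘ π₂))
    pair : ∀ {Z} {h : Z ⇒ _} {k : Z ⇒ _} → f ∘ h ≈ g ∘ k →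
           (f ∘ π₁) ∘ ⟨ h , k ⟩ ≈ (g ∘ π₂) ∘ ⟨ h , k ⟩
    pair p = ≈-trans assoc (≈-trans (∘-resp-≈ʳ project₁) (≈-trans p
               (≈-trans (∘-resp-≈ʳ (≈-sym project₂)) (≈-sym assoc))))
    arr-monic : ∀ {Z} {u v : Z ⇒ E.apex} → E.arr ∘ u ≈ E.arr ∘ v → u ≈ v
    arr-monic {v = v} p = ≈-trans (E.unique q p) (≈-sym (E.unique q ≈-refl))
      where
      q : (f ∘ π₁) ∘ (E.arr ∘ v) ≈ (g ∘ π₂) ∘ (E.arr ∘ v)
      q = ≈-trans (≈-sym assoc) (≈-trans (∘-resp-≈ˡ E.equality) assoc)

  Relation : Obj → Set (o ⊔ ℓ ⊔ e)
  Relation X = Subobject C (X ⊗ X)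

  module _ {X : Obj} (R : Relation X) where
    open Subobject R

    fst : dom ⇒ X
    fst = π₁ ∘ arr

    snd : dom ⇒ X
    snd = π₂ ∘ arr

  ker : ∀ {X Y} → X ⇒ Y → Relation X
  ker f = record
    { dom  = apex
    ; arr  = ⟨ p₁ , p₂ ⟩
    ; mono = λ u v p → unique
        (≈-trans (∘-resp-≈ˡ (≈-sym project₁)) (≈-trans assoc (≈-trans (∘-resp-≈ʳ p)
          (≈-trans (≈-sym assoc) (∘-resp-≈ˡ project₁)))))
        (≈-trans (∘-resp-≈ˡ (≈-sym project₂)) (≈-trans assoc (≈-trans (∘-resp-≈ʳ p)
          (≈-trans (≈-sym assoc) (∘-resp-≈ˡ project₂)))))
    }
    where
    open Pullback (pullback f f)
    open IsPullback isPullback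

  IsKernelOf : ∀ {X Y} → Relation X → X ⇒ Y → Set (o ⊔ ℓ ⊔ e)
  IsKernelOf R f = IsPullback C (fst R) (snd R) f f

  ker-isKernel : ∀ {X Y} (f : X ⇒ Y) → IsKernelOf (ker f) f
  ker-isKernel f = record
    { commute   = ≈-trans (∘-resp-≈ʳ project₁) (≈-trans commute (∘-resp-≈ʳ (≈-sym project₂)))
    ; universal = universal
    ; factor₁   = λ p → ≈-trans (∘-resp-≈ˡ project₁) (factor₁ p)
    ; factor₂   = λ p → ≈-trans (∘-resp-≈ˡ project₂) (factor₂ p)
    ; unique    = λ p q → unique
        (≈-trans (∘-resp-≈ˡ (≈-sym project₁)) (≈-trans p (∘-resp-≈ˡ project₁)))
        (≈-trans (∘-resp-≈ˡ (≈-sym project₂)) (≈-trans q (∘-resp-≈ˡ project₂)))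
    }
    where
    open Pullback (pullback f f)
    open IsPullback isPullback

  full-isKernel : ∀ {X} → IsKernelOf (full C (X ⊗ X)) (! {X})
  full-isKernel {X} = record
    { commute   = ≈-trans (≈-sym (Terminal.!-unique terminal _)) (Terminal.!-unique terminal _)
    ; universal = λ {_} {h} {k} _ → ⟨ h , k ⟩
    ; factor₁   = λ _ → ≈-trans (∘-resp-≈ˡ identityʳ) project₁
    ; factor₂   = λ _ → ≈-trans (∘-resp-≈ˡ identityʳ) project₂
    ; unique    = λ p q → π-jointly-monic
        (≈-trans (∘-resp-≈ˡ (≈-sym identityʳ)) (≈-trans p (∘-resp-≈ˡ identityʳ)))
        (≈-trans (∘-resp-≈ˡ (≈-sym identityʳ)) (≈-trans q (∘-resp-≈ˡ identityʳ)))
    }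

  infix 4 _⊑ker_

  _⊑ker_ : ∀ {X Y} → Relation X → X ⇒ Y → Set e
  R ⊑ker h = h ∘ fst R ≈ h ∘ snd R

  ⊑-kernel : ∀ {X Y} (R : Relation X) {S : Relation X} {h : X ⇒ Y} → IsKernelOf S h → R ⊑ker h → _⊑_ C R S
  ⊑-kernel R {S} isK p = universal p ,
    π-jointly-monic (≈-trans (≈-sym assoc) (factor₁ p)) (≈-trans (≈-sym assoc) (factor₂ p))
    where open IsPullback isK

  ⊑-⊑ker : ∀ {X Y} {R S : Relation X} {h : X ⇒ Y} → _⊑_ C R S → S ⊑ker h → R ⊑ker h
  ⊑-⊑ker {R = R} {S} {h} (u , su≈r) p = begin
    h ∘ (π₁ ∘ R.arr)        ≈⟨ ∘-resp-≈ʳ (∘-resp-≈ʳ su≈r) ⟨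
    h ∘ (π₁ ∘ (S.arr ∘ u))  ≈⟨ ∘-resp-≈ʳ assoc ⟨
    h ∘ (fst S ∘ u)         ≈⟨ assoc ⟨
    (h ∘ fst S) ∘ u         ≈⟨ ∘-resp-≈ˡ p ⟩
    (h ∘ snd S) ∘ u         ≈⟨ assoc ⟩
    h ∘ (snd S ∘ u)         ≈⟨ ∘-resp-≈ʳ assoc ⟩
    h ∘ (π₂ ∘ (S.arr ∘ u))  ≈⟨ ∘-resp-≈ʳ (∘-resp-≈ʳ su≈r) ⟩
    h ∘ (π₂ ∘ R.arr)        ∎
    where
    module R = Subobject R
    module S = Subobject S
    open HomReasoning

  ⊑ker-∘ : ∀ {X Y Z} (R : Relation X) {h : X ⇒ Y} (g : Y ⇒ Z) → R ⊑ker h → R ⊑ker g ∘ h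
  ⊑ker-∘ R g p = ≈-trans assoc (≈-trans (∘-resp-≈ʳ p) (≈-sym assoc))

  ⊑ker-resp-≈ : ∀ {X Y} (R : Relation X) {h k : X ⇒ Y} → h ≈ k → R ⊑ker h → R ⊑ker k
  ⊑ker-resp-≈ R h≈k p = ≈-trans (∘-resp-≈ˡ (≈-sym h≈k)) (≈-trans p (∘-resp-≈ˡ h≈k))

  ⊑ker-⟨⟩ : ∀ {X Y Z} (R : Relation X) {h : X ⇒ Y} {k : X ⇒ Z} →
            R ⊑ker h → R ⊑ker k → R ⊑ker ⟨ h , k ⟩
  ⊑ker-⟨⟩ R p q = π-jointly-monic (via project₁ p) (via project₂ q)
    where
    via : ∀ {A B D W} {x : A ⇒ D} {y : B ⇒ A} {z : B ⇒ D} {a b : W ⇒ B} →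
          x ∘ y ≈ z → z ∘ a ≈ z ∘ b → x ∘ (y ∘ a) ≈ x ∘ (y ∘ b)
    via xy≈z za≈zb = ≈-trans (≈-sym assoc) (≈-trans (∘-resp-≈ˡ xy≈z) (≈-trans za≈zb
                       (≈-trans (∘-resp-≈ˡ (≈-sym xy≈z)) assoc)))

module Quotients {o ℓ e : Level} (C : Category o ℓ e)
                 (finComplete : FinitelyComplete C) (coequalizer : HasCoequalizers C) where
  open Category C
  open Kernels C finComplete

  module _ {X : Obj} (R : Relation X) where
    open Coequalizer (coequalizer (fst R) (snd R))

    quotient : Obj
    quotient = obj

    κ : X ⇒ quotient
    κ = arr

    κ-isCoequalizer : IsCoequalizer C (fst R) (snd R) κ
    κ-isCoequalizer = isCoequalizer

    open IsCoequalizer κ-isCoequalizer public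
      using () renaming (coequalize to κ-lift; factor to κ-factor)

    κ-equality : R ⊑ker κ
    κ-equality = IsCoequalizer.equality κ-isCoequalizer

    κ-epi : ∀ {Z} {u v : quotient ⇒ Z} → u ∘ κ ≈ v ∘ κ → u ≈ v
    κ-epi = coequalizer-epi κ-isCoequalizer

    κ-regularEpi : IsRegularEpi C κ
    κ-regularEpi = _ , _ , _ , κ-isCoequalizer

  module _ {X : Obj} {R S : Relation X} (R⊑S : _⊑_ C R S) where

    coarsen : quotient R ⇒ quotient S
    coarsen = κ-lift R (⊑-⊑ker R⊑S (κ-equality S))

    coarsen-κ : coarsen ∘ κ R ≈ κ S
    coarsen-κ = κ-factor R (⊑-⊑ker R⊑S (κ-equality S))

    coarsen-regularEpi : IsRegularEpi C coarsen
    coarsen-regularEpi = regularEpi-cancel (κ-epi R) coarsen-κ (κ-regularEpi S)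

  -- The second half of the (regular epi, mono)-factorization of a morphism is monic.
  lift-mono : RegularEpisCompose C → ∀ {X Y} (S : Relation X) {f : X ⇒ Y} →
              IsKernelOf S f → {m : quotient S ⇒ Y} → m ∘ κ S ≈ f → IsMono C m
  lift-mono compose {X} {Y} S {f} isK {m} mκ≈f u v mu≈mv = begin
    u              ≈⟨ identityˡ ⟨
    id ∘ u         ≈⟨ ∘-resp-≈ˡ tε≈id ⟨
    (t ∘ ε) ∘ u    ≈⟨ assoc ⟩
    t ∘ (ε ∘ u)    ≈⟨ ∘-resp-≈ʳ εu≈εv ⟩
    t ∘ (ε ∘ v)    ≈⟨ assoc ⟨
    (t ∘ ε) ∘ v    ≈⟨ ∘-resp-≈ˡ tε≈id ⟩
    id ∘ v         ≈⟨ identityˡ ⟩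
    v              ∎
    where
    open HomReasoning
    module K = IsPullback (ker-isKernel m)
    ε : quotient S ⇒ quotient (ker m)
    ε = κ (ker m)
    m′ : quotient (ker m) ⇒ Y
    m′ = κ-lift (ker m) K.commute
    m′ε≈m : m′ ∘ ε ≈ m
    m′ε≈m = κ-factor (ker m) K.commute
    εκ-regular : IsRegularEpi C (ε ∘ κ S)
    εκ-regular = compose ε (κ S) (κ-regularEpi (ker m)) (κ-regularEpi S)
    a b : proj₁ εκ-regular ⇒ X
    a = proj₁ (proj₂ εκ-regular)
    b = proj₁ (proj₂ (proj₂ εκ-regular))
    module E = IsCoequalizer (proj₂ (proj₂ (proj₂ εκ-regular)))
    f≈ : m′ ∘ (ε ∘ κ S) ≈ f
    f≈ = ≈-trans (≈-sym assoc) (≈-trans (∘-resp-≈ˡ m′ε≈m) mκ≈f)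
    fa≈fb : f ∘ a ≈ f ∘ b
    fa≈fb = begin
      f ∘ a                   ≈⟨ ∘-resp-≈ˡ f≈ ⟨
      (m′ ∘ (ε ∘ κ S)) ∘ a    ≈⟨ assoc ⟩
      m′ ∘ ((ε ∘ κ S) ∘ a)    ≈⟨ ∘-resp-≈ʳ E.equality ⟩
      m′ ∘ ((ε ∘ κ S) ∘ b)    ≈⟨ assoc ⟨
      (m′ ∘ (ε ∘ κ S)) ∘ b    ≈⟨ ∘-resp-≈ˡ f≈ ⟩
      f ∘ b                   ∎
    w : proj₁ εκ-regular ⇒ Subobject.dom S
    w = IsPullback.universal isK fa≈fb
    κa≈κb : κ S ∘ a ≈ κ S ∘ b
    κa≈κb = begin
      κ S ∘ a              ≈⟨ ∘-resp-≈ʳ (IsPullback.factor₁ isK fa≈fb) ⟨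
      κ S ∘ (fst S ∘ w)    ≈⟨ assoc ⟨
      (κ S ∘ fst S) ∘ w    ≈⟨ ∘-resp-≈ˡ (κ-equality S) ⟩
      (κ S ∘ snd S) ∘ w    ≈⟨ assoc ⟩
      κ S ∘ (snd S ∘ w)    ≈⟨ ∘-resp-≈ʳ (IsPullback.factor₂ isK fa≈fb) ⟩
      κ S ∘ b              ∎
    t : quotient (ker m) ⇒ quotient S
    t = E.coequalize κa≈κb
    tε≈id : t ∘ ε ≈ id
    tε≈id = κ-epi S (≈-trans assoc (≈-trans (E.factor κa≈κb) (≈-sym identityˡ)))
    εu≈εv : ε ∘ u ≈ ε ∘ v
    εu≈εv = begin
      ε ∘ u                                   ≈⟨ ∘-resp-≈ʳ (K.factor₁ mu≈mv) ⟨
      ε ∘ (fst (ker m) ∘ K.universal mu≈mv)   ≈⟨ assoc ⟨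
      (ε ∘ fst (ker m)) ∘ K.universal mu≈mv   ≈⟨ ∘-resp-≈ˡ (κ-equality (ker m)) ⟩
      (ε ∘ snd (ker m)) ∘ K.universal mu≈mv   ≈⟨ assoc ⟩
      ε ∘ (snd (ker m) ∘ K.universal mu≈mv)   ≈⟨ ∘-resp-≈ʳ (K.factor₂ mu≈mv) ⟩
      ε ∘ v                                   ∎

-- Categorical partition refinement.  The iteration is carried on for all i : ℕ;
-- up to the first i with P i ≋ Q i this is the run of the algorithm with its
-- stopping condition.
module PartitionRefinement {o ℓ e : Level} (C : Category o ℓ e)
    (finComplete : FinitelyComplete C) (coequalizer : HasCoequalizers C)
    (compose : RegularEpisCompose C)
    (H : Functor C C) (preservesMonos : PreservesMonos H)
    (coalgebra : Coalgebra H) (selectRoutine : SelectRoutine C) where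
  open Category C
  open Functor H
  open Coalgebra coalgebra renaming (Carrier to X; structure to ξ)
  open SelectRoutine selectRoutine
  open Kernels C finComplete
  open Quotients C finComplete coequalizer

  -- K̄ is the product of K₀, …, Kᵢ, associated to the left, and q̄ = ⟨q₀, …, qᵢ⟩.
  record State : Set (o ⊔ ℓ ⊔ e) where
    field
      K̄ : Obj
      q̄ : X ⇒ K̄
      Q : Relation X

    P : Relation X
    P = ker (F₁ q̄ ∘ ξ)

    field
      Q-isKernel : IsKernelOf Q q̄
      P⊑Q        : _⊑_ C P Q

  initial : State
  initial = record
    { K̄          = 𝟙
    ; q̄          = !
    ; Q          = full C (X ⊗ X)
    ; Q-isKernel = full-isKernel
    ; P⊑Q        = _ , identityˡ
    }

  module Step (s : State) where
    open State s

    f : quotient P ⇒ quotient Q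
    f = coarsen P⊑Q

    K : Obj
    K = target (κ P) f (κ-regularEpi P) (coarsen-regularEpi P⊑Q)

    q : X ⇒ K
    q = select (κ P) f (κ-regularEpi P) (coarsen-regularEpi P⊑Q) ∘ κ P

    next-q̄ : X ⇒ K̄ ⊗ K
    next-q̄ = ⟨ q̄ , q ⟩

    next-P⊑P : _⊑_ C (ker (F₁ next-q̄ ∘ ξ)) P
    next-P⊑P = ⊑-kernel (ker (F₁ next-q̄ ∘ ξ)) (ker-isKernel (F₁ q̄ ∘ ξ))
      (⊑ker-resp-≈ (ker (F₁ next-q̄ ∘ ξ))
        (≈-trans (≈-sym assoc)
          (∘-resp-≈ˡ (≈-trans (≈-sym homomorphism) (F-resp-≈ project₁))))
        (⊑ker-∘ (ker (F₁ next-q̄ ∘ ξ)) (F₁ π₁)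
          (IsPullback.commute (ker-isKernel (F₁ next-q̄ ∘ ξ)))))

    P⊑next-Q : _⊑_ C P (ker next-q̄)
    P⊑next-Q = ⊑-kernel P (ker-isKernel next-q̄)
      (⊑ker-⟨⟩ P (⊑-⊑ker P⊑Q (IsPullback.commute Q-isKernel))
                  (⊑ker-∘ P _ (κ-equality P)))

    next : State
    next = record
      { K̄          = K̄ ⊗ K
      ; q̄          = next-q̄
      ; Q          = ker next-q̄
      ; Q-isKernel = ker-isKernel next-q̄
      ; P⊑Q        = ⊑-kernel (ker (F₁ next-q̄ ∘ ξ)) (ker-isKernel next-q̄)
                       (⊑-⊑ker next-P⊑P (⊑-⊑ker P⊑next-Q
                         (IsPullback.commute (ker-isKernel next-q̄))))
      }

  state : ℕ → State
  state zero    = initial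
  state (suc i) = Step.next (state i)

  P : ℕ → Relation X
  P i = State.P (state i)

  Q : ℕ → Relation X
  Q i = State.Q (state i)

  module _ (i : ℕ) where
    private
      module S = State (state i)

      m : quotient S.Q ⇒ S.K̄
      m = κ-lift S.Q (IsPullback.commute S.Q-isKernel)

      m-κ : m ∘ κ S.Q ≈ S.q̄
      m-κ = κ-factor S.Q (IsPullback.commute S.Q-isKernel)

      Hm-mono : IsMono C (F₁ m)
      Hm-mono = preservesMonos m (lift-mono compose S.Q S.Q-isKernel m-κ)

    P⊑ker-Hκ∘ξ : P i ⊑ker F₁ (κ (Q i)) ∘ ξ
    P⊑ker-Hκ∘ξ = Hm-mono _ _
      (≈-trans (≈-sym assoc) (≈-trans
        (⊑ker-resp-≈ (P i)
          (≈-sym (≈-trans (≈-sym assoc)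
            (∘-resp-≈ˡ (≈-trans (≈-sym homomorphism) (F-resp-≈ m-κ)))))
          (IsPullback.commute (ker-isKernel (F₁ S.q̄ ∘ ξ))))
        assoc))

    ξ/Q : quotient (P i) ⇒ F₀ (quotient (Q i))
    ξ/Q = κ-lift (P i) P⊑ker-Hκ∘ξ

    ξ/Q-κ : ξ/Q ∘ κ (P i) ≈ F₁ (κ (Q i)) ∘ ξ
    ξ/Q-κ = κ-factor (P i) P⊑ker-Hκ∘ξ

  -- P i and Q i are equal only as subobjects, so ξ/Q i becomes a structure on
  -- X/Q i through the canonical isomorphism X/Q i → X/P i.
  quotientCoalgebra : ∀ i → _≋_ C (P i) (Q i) → Coalgebra H
  quotientCoalgebra i (_ , Q⊑P) = record
    { Carrier   = quotient (Q i)
    ; structure = ξ/Q i ∘ coarsen Q⊑P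
    }

{-# OPTIONS --safe #-}
-- A quotient h of X/Qᵢ yields the quotient h ∘ κ of the coalgebra X.  Every q̄ⱼ
-- factors through each quotient k of X, by induction on j: if q̄ⱼ = g ∘ k then
-- H q̄ⱼ ∘ ξ = H g ∘ ζ ∘ k, so the kernel of k is finer than Pⱼ and therefore than
-- the kernel of q̄ⱼ₊₁.  Hence the kernel of h ∘ κ is finer than Qᵢ, which makes h
-- split monic; being epic as well, it is invertible.
module Submission where

open import Level using (Level)
open import Data.Nat.Base using (ℕ; zero; suc)
open import Data.Product.Base using (Σ-syntax; _,_; proj₁; proj₂)
open import Defs

module _ {o ℓ e : Level} (C : Category o ℓ e) where
  open Category C

  regularEpi-epi : ∀ {A B Z} {c : A ⇒ B} → IsRegularEpi C c →
                   {u v : B ⇒ Z} → u ∘ c ≈ v ∘ c → u ≈ v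
  regularEpi-epi (_ , _ , _ , isC) = coequalizer-epi isC

  -- Stated for an arbitrary parallel pair, because the pair that presents a regular epimorphism
  -- need not be jointly monic and so need not be a `Relation`.
  equalizes-∘ : ∀ {A B D E} {a b : A ⇒ B} {f : B ⇒ D} (g : D ⇒ E) →
                f ∘ a ≈ f ∘ b → (g ∘ f) ∘ a ≈ (g ∘ f) ∘ b
  equalizes-∘ g p = ≈-trans assoc (≈-trans (∘-resp-≈ʳ p) (≈-sym assoc))

  equalizes-resp-≈ : ∀ {A B D} {a b : A ⇒ B} {f g : B ⇒ D} →
                     f ≈ g → f ∘ a ≈ f ∘ b → g ∘ a ≈ g ∘ b
  equalizes-resp-≈ f≈g p =
    ≈-trans (∘-resp-≈ˡ (≈-sym f≈g)) (≈-trans p (∘-resp-≈ˡ f≈g))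

  module _ (finComplete : FinitelyComplete C) where
    open Kernels C finComplete

    -- The pair `a`, `b` factors through the kernel pair `S`, on whose projections `k` agrees.
    kernel-equalizes : ∀ {W X Y Z} (S : Relation X) {f : X ⇒ Y} → IsKernelOf S f →
                       {k : X ⇒ Z} → S ⊑ker k →
                       {a b : W ⇒ X} → f ∘ a ≈ f ∘ b → k ∘ a ≈ k ∘ b
    kernel-equalizes S isK {k} S⊑k {a} {b} p = begin
      k ∘ a                      ≈⟨ ∘-resp-≈ʳ (factor₁ p) ⟨
      k ∘ (fst S ∘ universal p)  ≈⟨ assoc ⟨
      (k ∘ fst S) ∘ universal p  ≈⟨ ∘-resp-≈ˡ S⊑k ⟩
      (k ∘ snd S) ∘ universal p  ≈⟨ assoc ⟩
      k ∘ (snd S ∘ universal p)  ≈⟨ ∘-resp-≈ʳ (factor₂ p) ⟩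
      k ∘ b                      ∎
      where
      open IsPullback isK
      open HomReasoning

    equalizes-⟨⟩ : ∀ {W X Y Z} {a b : W ⇒ X} {f : X ⇒ Y} {g : X ⇒ Z} →
                   f ∘ a ≈ f ∘ b → g ∘ a ≈ g ∘ b → ⟨ f , g ⟩ ∘ a ≈ ⟨ f , g ⟩ ∘ b
    equalizes-⟨⟩ p q = π-jointly-monic
      (≈-trans (≈-sym assoc) (≈-trans (equalizes-resp-≈ (≈-sym project₁) p) assoc))
      (≈-trans (≈-sym assoc) (≈-trans (equalizes-resp-≈ (≈-sym project₂) q) assoc))

module _ {o ℓ e : Level} {C : Category o ℓ e} (H : Functor C C) where
  open Category C
  open Functor H
  open CoalgebraMorphism

  -- Carries a factorization through `k` one step along the coalgebra structure: this drives the
  -- induction on `q̄`, and with `r` the identity it shows that a retraction of a quotient is a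
  -- coalgebra morphism.
  structure-factors : ∀ {A B : Coalgebra H} (k : CoalgebraMorphism H A B) {Z}
                      {r : Coalgebra.Carrier A ⇒ Z} (g : Coalgebra.Carrier B ⇒ Z) →
                      g ∘ map k ≈ r →
                      (F₁ g ∘ Coalgebra.structure B) ∘ map k ≈ F₁ r ∘ Coalgebra.structure A
  structure-factors k g gk≈r =
    ≈-trans assoc (≈-trans (∘-resp-≈ʳ (commutes k)) (≈-trans (≈-sym assoc)
      (∘-resp-≈ˡ (≈-trans (≈-sym homomorphism) (F-resp-≈ gk≈r)))))

  splitMonic-quotient-isIso : ∀ {A B : Coalgebra H} (h : CoalgebraMorphism H A B) →
                              IsQuotient H h →
                              (t : Coalgebra.Carrier B ⇒ Coalgebra.Carrier A) →
                              t ∘ map h ≈ id → IsIso (Coalgebras H) h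
  splitMonic-quotient-isIso {A} {B} h regular t th≈id = record
    { inv  = record
        { map      = t
        -- Since `map h` is epic, the equation need only be checked after precomposing with it.
        ; commutes = regularEpi-epi C regular (begin
            (A.structure ∘ t) ∘ map h       ≈⟨ assoc ⟩
            A.structure ∘ (t ∘ map h)       ≈⟨ ∘-resp-≈ʳ th≈id ⟩
            A.structure ∘ id                ≈⟨ identityʳ ⟩
            A.structure                     ≈⟨ identityˡ ⟨
            id ∘ A.structure                ≈⟨ ∘-resp-≈ˡ identity ⟨
            F₁ id ∘ A.structure             ≈⟨ structure-factors h t th≈id ⟨
            (F₁ t ∘ B.structure) ∘ map h    ∎)
        }
    ; isoˡ = th≈id
    ; isoʳ = regularEpi-epi C regular (≈-trans assoc (≈-trans (∘-resp-≈ʳ th≈id)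
               (≈-trans identityʳ (≈-sym identityˡ))))
    }
    where
    module A = Coalgebra A
    module B = Coalgebra B
    open HomReasoning

module _ {o ℓ e : Level} (C : Category o ℓ e)
    (finComplete : FinitelyComplete C) (coequalizer : HasCoequalizers C)
    (compose : RegularEpisCompose C)
    (H : Functor C C) (preservesMonos : PreservesMonos H)
    (coalgebra : Coalgebra H) (selectRoutine : SelectRoutine C) where
  open Category C
  open Functor H
  open CoalgebraMorphism
  open Coalgebra coalgebra renaming (Carrier to X; structure to ξ)
  open Kernels C finComplete
  open Quotients C finComplete coequalizer
  open PartitionRefinement C finComplete coequalizer compose H preservesMonos
    coalgebra selectRoutine

  private
    module S (j : ℕ) = State (state j)

  module _ {B : Coalgebra H} (k : CoalgebraMorphism H coalgebra B) (regular : IsQuotient H k) where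
    private
      open IsCoequalizer (proj₂ (proj₂ (proj₂ regular)))

      a b : proj₁ regular ⇒ X
      a = proj₁ (proj₂ regular)
      b = proj₁ (proj₂ (proj₂ regular))

      -- As `map k` is the coequalizer of `a` and `b`, this and `coequalize` turn factoring through
      -- `k` into agreement on one pair, which stands in for the kernel of `k`.
      equalizes : ∀ {Z} {r : X ⇒ Z} {g : Coalgebra.Carrier B ⇒ Z} →
                  g ∘ map k ≈ r → r ∘ a ≈ r ∘ b
      equalizes {g = g} gk≈r = equalizes-resp-≈ C gk≈r (equalizes-∘ C g equality)

    q̄-factors : ∀ j → Σ[ g ∈ Coalgebra.Carrier B ⇒ S.K̄ j ] g ∘ map k ≈ S.q̄ j
    q̄-factors zero    = ! , ≈-trans (≈-sym (!-unique _)) (!-unique _)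
      where open Terminal (FinitelyComplete.terminal finComplete) using (!-unique)
    q̄-factors (suc j) = coequalize next , factor next
      where
      g = proj₁ (q̄-factors j)
      gk≈q̄ = proj₂ (q̄-factors j)
      κ-equalizes : κ (P j) ∘ a ≈ κ (P j) ∘ b
      κ-equalizes = kernel-equalizes C finComplete (P j) (ker-isKernel (F₁ (S.q̄ j) ∘ ξ))
        (κ-equality (P j)) (equalizes (structure-factors H k g gk≈q̄))
      next : S.q̄ (suc j) ∘ a ≈ S.q̄ (suc j) ∘ b
      -- The new component is the selected morphism after `κ (P j)`, so it agrees on `a` and `b`
      -- whatever `select` returns.
      next = equalizes-⟨⟩ C finComplete (equalizes gk≈q̄) (equalizes-∘ C _ κ-equalizes)

    κQ-factors : ∀ i → Σ[ t ∈ Coalgebra.Carrier B ⇒ quotient (Q i) ] t ∘ map k ≈ κ (Q i)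
    κQ-factors i = coequalize p , factor p
      where
      p : κ (Q i) ∘ a ≈ κ (Q i) ∘ b
      p = kernel-equalizes C finComplete (Q i) (S.Q-isKernel i) (κ-equality (Q i))
            (equalizes (proj₂ (q̄-factors i)))

  -- The comparison `coarsen Q⊑P` sends `κ (Q i)` to `κ (P i)`, where the defining equation of
  -- `ξ/Q i` applies.
  κ-morphism : ∀ i (P≋Q : _≋_ C (P i) (Q i)) →
               CoalgebraMorphism H coalgebra (quotientCoalgebra i P≋Q)
  κ-morphism i (_ , Q⊑P) = record
    { map      = κ (Q i)
    ; commutes = ≈-trans assoc (≈-trans (∘-resp-≈ʳ (coarsen-κ Q⊑P)) (ξ/Q-κ i))
    }

  quotientCoalgebra-simple : ∀ i (P≋Q : _≋_ C (P i) (Q i)) →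
                             IsSimple H (quotientCoalgebra i P≋Q)
  quotientCoalgebra-simple i P≋Q B h regular =
    splitMonic-quotient-isIso H h regular t
      -- Both `t ∘ map h` and `id` give `κ (Q i)` when precomposed with the epic `κ (Q i)`.
      (κ-epi (Q i) (≈-trans assoc (≈-trans thκ≈κ (≈-sym identityˡ))))
    where
    hκ : CoalgebraMorphism H coalgebra B
    hκ = Category._∘_ (Coalgebras H) h (κ-morphism i P≋Q)
    factorization = κQ-factors hκ (compose (map h) (κ (Q i)) regular (κ-regularEpi (Q i))) i
    t = proj₁ factorization
    thκ≈κ = proj₂ factorization

theorem4p14 : {o ℓ e : Level} (C : Category o ℓ e)
    (finComplete : FinitelyComplete C) (coequalizer : HasCoequalizers C)
    (compose : RegularEpisCompose C)
    (H : Functor C C) (preservesMonos : PreservesMonos H)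
    (ξ : Coalgebra H) (select : SelectRoutine C) →
    let open PartitionRefinement C finComplete coequalizer compose H preservesMonos ξ select in
    (i : ℕ) (P≋Q : _≋_ C (P i) (Q i)) →
    IsSimple H (quotientCoalgebra i P≋Q)
theorem4p14 = quotientCoalgebra-simple
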